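{- The spherical tiling by $12$ combinatorially congruent pentagons is unique up to combinatorial isomorphism, and is the dodecahedron. Explicitly, the tiles of any such tiling can be labelled $P_1,\dots,P_{12}$ so that, for each $i$, the tile $P_i$ with the list $(n_1,\dots,n_5)$ below has as its edges, in cyclic order, $E_{i,n_1},\dots,E_{i,n_5}$, where $E_{i,j}=E_{j,i}$ is the unique common edge of $P_i$ and $P_j$, and (with $n_6=n_1$) consecutive edges $E_{i,n_k},E_{i,n_{k+1}}$ meet at a vertex $V_{i,n_k,n_{k+1}}$ of degree $3$ shared by exactly the tiles $P_i,P_{n_k},P_{n_{k+1}}$: $P_1:(2,3,4,5,6)$; $P_2:(1,6,11,7,3)$; $P_3:(1,2,7,8,4)$; $P_4:(1,3,8,9,5)$; $P_5:(1,4,9,10,6)$; $P_6:(1,5,10,11,2)$; $P_7:(12,8,3,2,11)$; $P_8:(12,9,4,3,7)$; $P_9:(12,10,5,4,8)$; $P_{10}:(12,11,6,5,9)$; $P_{11}:(12,7,2,6,10)$; $P_{12}:(7,11,10,9,8)$.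
   Context: A spherical tiling is given by a finite connected graph nicely embedded in $S^2$ (edges may be any reasonably nice curves) with all vertices of degree $\ge 3$; the tiles are the closures of the connected components of the complement of the graph. It is a tiling by combinatorially congruent pentagons if every tile has exactly five edges and no tile has boundary points identified (i.e. every tile is a region enclosed by a simple closed curve). -}

module Defs where

open import Algebra.Definitions using (Involutive)
open import Data.Fin using (Fin; zero; suc; #_)
open import Data.Fin.Permutation using (Permutation; Permutation′; _⟨$⟩ʳ_)
open import Data.Fin.Properties using (_≟_)
open import Data.Nat using (ℕ; _+_; _≤_)
open import Data.Nat.GeneralisedArithmetic using (iterate)
open import Data.Product using (∃; _×_)
open import Data.Sum using (_⊎_)
open import Data.Vec using (Vec; []; _∷_; lookup; count; allFin)
open import Function.Base using (_∘_)
open import Function.Bundles using (_⇔_)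
open import Function.Definitions using (Surjective)
open import Relation.Binary.Construct.Closure.ReflexiveTransitive using (Star)
open import Relation.Binary.PropositionalEquality using (_≡_; _≢_)

-- A quotient of Fin n by the orbits of f, presented as Fin size.  Forward
-- iterates suffice because f is always a permutation below.
record Orbits {n : ℕ} (f : Fin n → Fin n) : Set where
  field
    size       : ℕ
    class      : Fin n → Fin size
    surjective : Surjective _≡_ _≡_ class
    exact      : ∀ x y → class x ≡ class y ⇔ ∃ λ k → iterate f x k ≡ y

  card : Fin size → ℕ
  card c = count (λ x → class x ≟ c) (allFin n)

-- A finite connected graph embedded in the sphere (loops and multiple edges
-- allowed, all degrees ≥ 3), given as a combinatorial map.  Darts are the
-- oriented edges.  The permutation σ sends a dart to the next one clockwise
-- around its tail, and α reverses a dart.  Then φ x is the dart following x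
-- on the boundary of the tile to the left of x.  By connectedness, the
-- surface carrying the map is the sphere exactly when V - E + F = 2.
record SphericalTiling : Set where
  field
    #darts : ℕ

  Dart : Set
  Dart = Fin #darts

  field
    rotation     : Permutation′ #darts
    α            : Dart → Dart
    α-involutive : Involutive _≡_ α
    α-no-fixed   : ∀ x → α x ≢ x

  σ : Dart → Dart
  σ = rotation ⟨$⟩ʳ_

  φ : Dart → Dart
  φ = σ ∘ α

  field
    vertices : Orbits σ
    edges    : Orbits α
    tiles    : Orbits φ

  open Orbits vertices public using ()
    renaming (size to #vertices; class to tail; card to degree)
  open Orbits edges public using ()
    renaming (size to #edges; class to edge)
  -- The perimeter counts an edge twice if the tile lies on both sides of it.
  open Orbits tiles public using ()
    renaming (size to #tiles; class to tile; card to perimeter)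

  Vertex : Set
  Vertex = Fin #vertices

  Edge : Set
  Edge = Fin #edges

  Tile : Set
  Tile = Fin #tiles

  head : Dart → Vertex
  head x = tail (α x)

  Adjacent : Vertex → Vertex → Set
  Adjacent v w = ∃ λ x → tail x ≡ v × head x ≡ w

  field
    connected : ∀ v w → Star Adjacent v w
    euler     : #vertices + #tiles ≡ #edges + 2
    degree≥3  : ∀ v → 3 ≤ degree v

  _isEdgeOf_ : Edge → Tile → Set
  e isEdgeOf t = ∃ λ x → edge x ≡ e × tile x ≡ t

  _isVertexOf_ : Vertex → Tile → Set
  v isVertexOf t = ∃ λ x → tail x ≡ v × tile x ≡ t

  IsUniqueCommonEdge : Edge → Tile → Tile → Set
  IsUniqueCommonEdge e s t =
    e isEdgeOf s × e isEdgeOf t ×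
    (∀ e′ → e′ isEdgeOf s → e′ isEdgeOf t → e′ ≡ e)

-- The last two fields say that the boundary walk of a tile repeats neither a
-- vertex nor an edge, i.e. that it is a simple closed curve.
record ByCongruentPentagons (T : SphericalTiling) : Set where
  open SphericalTiling T
  field
    five-edges      : ∀ t → perimeter t ≡ 5
    simple-vertices : ∀ x y → tile x ≡ tile y → tail x ≡ tail y → x ≡ y
    simple-edges    : ∀ x y → tile x ≡ tile y → edge x ≡ edge y → x ≡ y

ByTwelveCongruentPentagons : SphericalTiling → Set
ByTwelveCongruentPentagons T =
  ByCongruentPentagons T × SphericalTiling.#tiles T ≡ 12

-- Induced by a homeomorphism of the sphere, which may preserve or reverse
-- orientation; in the second case it conjugates σ to the inverse rotation.
record _≅_ (S T : SphericalTiling) : Set where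
  private
    module S = SphericalTiling S
    module T = SphericalTiling T
  field
    dartBijection : Permutation S.#darts T.#darts

  f : S.Dart → T.Dart
  f = dartBijection ⟨$⟩ʳ_

  field
    preserves-α : ∀ x → f (S.α x) ≡ T.α (f x)
    preserves-σ : (∀ x → f (S.σ x) ≡ T.σ (f x)) ⊎
                  (∀ x → T.σ (f (S.σ x)) ≡ f x)

next : Fin 5 → Fin 5
next zero                         = # 1
next (suc zero)                   = # 2
next (suc (suc zero))             = # 3
next (suc (suc (suc zero)))       = # 4
next (suc (suc (suc (suc zero)))) = # 0

p₁ p₂ p₃ p₄ p₅ p₆ p₇ p₈ p₉ p₁₀ p₁₁ p₁₂ : Fin 12
p₁  = # 0
p₂  = # 1
p₃  = # 2
p₄  = # 3
p₅  = # 4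
p₆  = # 5
p₇  = # 6
p₈  = # 7
p₉  = # 8
p₁₀ = # 9
p₁₁ = # 10
p₁₂ = # 11

neighbours : Vec (Vec (Fin 12) 5) 12
neighbours =
  (p₂  ∷ p₃  ∷ p₄  ∷ p₅  ∷ p₆  ∷ []) ∷
  (p₁  ∷ p₆  ∷ p₁₁ ∷ p₇  ∷ p₃  ∷ []) ∷
  (p₁  ∷ p₂  ∷ p₇  ∷ p₈  ∷ p₄  ∷ []) ∷
  (p₁  ∷ p₃  ∷ p₈  ∷ p₉  ∷ p₅  ∷ []) ∷
  (p₁  ∷ p₄  ∷ p₉  ∷ p₁₀ ∷ p₆  ∷ []) ∷
  (p₁  ∷ p₅  ∷ p₁₀ ∷ p₁₁ ∷ p₂  ∷ []) ∷
  (p₁₂ ∷ p₈  ∷ p₃  ∷ p₂  ∷ p₁₁ ∷ []) ∷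
  (p₁₂ ∷ p₉  ∷ p₄  ∷ p₃  ∷ p₇  ∷ []) ∷
  (p₁₂ ∷ p₁₀ ∷ p₅  ∷ p₄  ∷ p₈  ∷ []) ∷
  (p₁₂ ∷ p₁₁ ∷ p₆  ∷ p₅  ∷ p₉  ∷ []) ∷
  (p₁₂ ∷ p₇  ∷ p₂  ∷ p₆  ∷ p₁₀ ∷ []) ∷
  (p₇  ∷ p₁₁ ∷ p₁₀ ∷ p₉  ∷ p₈  ∷ []) ∷ []

nbr : Fin 12 → Fin 5 → Fin 12
nbr i k = lookup (lookup neighbours i) k

-- E and V are constrained only at the indices E_{i,n_k} and
-- V_{i,n_k,n_{k+1}} that the table produces.
record DodecahedralLabelling (T : SphericalTiling) : Set where
  open SphericalTiling T
  field
    labelling : Permutation 12 #tiles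

  P : Fin 12 → Tile
  P = labelling ⟨$⟩ʳ_

  field
    E             : Fin 12 → Fin 12 → Edge
    E-symmetric   : ∀ i k → E i (nbr i k) ≡ E (nbr i k) i
    E-common      : ∀ i k → IsUniqueCommonEdge (E i (nbr i k)) (P i) (P (nbr i k))
    boundary      : Fin 12 → Fin 5 → Dart
    boundary-tile : ∀ i k → tile (boundary i k) ≡ P i
    boundary-edge : ∀ i k → edge (boundary i k) ≡ E i (nbr i k)
    boundary-next : ∀ i k → φ (boundary i k) ≡ boundary i (next k)

    V        : Fin 12 → Fin 12 → Fin 12 → Vertex
    V-corner : ∀ i k → let v = V i (nbr i k) (nbr i (next k)) in
               head (boundary i k) ≡ v × tail (boundary i (next k)) ≡ v
    V-degree : ∀ i k → degree (V i (nbr i k) (nbr i (next k))) ≡ 3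
    V-tiles  : ∀ i k t → V i (nbr i k) (nbr i (next k)) isVertexOf t ⇔
               (t ≡ P i ⊎ t ≡ P (nbr i k) ⊎ t ≡ P (nbr i (next k)))

{-# OPTIONS --safe #-}
-- Counting darts tile by tile gives 60, so there are at least 30 edges, and
-- then at least 20 vertices by Euler's formula; hence every degree is exactly
-- 3.  So the permutations of the darts satisfy φ⁵ = α² = (φα)³ = 1, which
-- present the group A₅ of order 60.  These relations suffice to
-- develop the dodecahedron from any dart: glue twelve pentagons along a
-- spanning tree of the adjacency graph of the tiles, then repeatedly use that
-- two glued edges at a vertex of degree 3 force the third one.  The resulting
-- map from the 60 sides of the table onto the darts is bijective by counting.
module Submission where

open import Defs
open import Algebra.Properties.CommutativeMonoid.Sum using (sum; ∑-distrib-+; sum-cong-≗; sum-replicate-zero)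
open import Data.Bool using (if_then_else_)
open import Data.Fin using (Fin; zero; suc; toℕ; fromℕ<; punchOut; #_; cast; combine; remQuot)
  renaming (_<_ to _<ᶠ_)
open import Data.Fin.Induction using (<-wellFounded)
open import Data.Fin.Permutation using (permutation)
open import Data.Fin.Properties
  using (_≟_; _<?_; any?; all?; pigeonhole; injective⇒≤; toℕ<n; toℕ-fromℕ<; suc-injective; punchOut-injective; remQuot-combine)
open import Data.List using (List; []; _∷_)
open import Data.List.Membership.Propositional using (_∈_)
open import Data.List.Relation.Unary.All as All using (All; []; _∷_)
open import Data.Nat as ℕ using (ℕ; zero; suc; _+_; _*_; _∸_; _≤_; _<_; s≤s; s≤s⁻¹; z≤n; NonZero; >-nonZero)
open import Data.Nat.DivMod using (_/_; _%_; m≡m%n+[m/n]*n; m%n<n)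
open import Data.Nat.GeneralisedArithmetic using (iterate)
open import Data.Nat.Properties
  using (+-0-commutativeMonoid; +-mono-≤; +-monoʳ-≤; +-monoˡ-≤; +-cancelʳ-≤; +-cancelˡ-≤; +-comm; *-suc; *-monoˡ-≤; *-cancelʳ-≤;
         ≤-antisym; ≤-trans; ≤-reflexive; ≤-refl; <-irrefl; <⇒≤; n<1+n; m∸n+n≡m; m<n⇒0<n∸m; m∸n≤m)
open import Data.Product using (∃; _×_; _,_; proj₁; proj₂)
open import Data.Product.Properties using (≡-dec)
open import Data.Sum as Sum using (_⊎_; inj₁; inj₂; [_,_]′)
open import Data.Vec using (Vec; []; _∷_; lookup; count; allFin)
open import Data.Vec.Properties using (lookup-allFin)
open import Function.Base using (_∘_)
open import Function.Bundles using (Equivalence; Injection; _⇔_; mk⇔)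
open import Function.Definitions using (Injective)
open import Function.Properties.Inverse using (↔⇒↣)
open import Induction.WellFounded using (Acc; acc)
open import Relation.Binary.Construct.Closure.ReflexiveTransitive using (Star; ε; _◅_; _◅◅_; reverse)
open import Relation.Binary.Definitions using (DecidableEquality)
open import Relation.Binary.PropositionalEquality
  using (_≡_; _≢_; refl; sym; trans; cong; cong₂; subst; module ≡-Reasoning)
open import Relation.Nullary using (Dec; does; yes; no; contradiction)
open import Relation.Nullary.Decidable using (_×-dec_; _⊎-dec_; _→-dec_; from-yes; ¬?)
open import Relation.Unary using (Pred; Decidable)

-- Sums over finite index sets

∑ : ∀ {n} → (Fin n → ℕ) → ℕ
∑ = sum +-0-commutativeMonoid

∑-lower : ∀ {n} k (t : Fin n → ℕ) → (∀ i → k ≤ t i) → n * k ≤ ∑ t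
∑-lower {zero}  k t k≤ = z≤n
∑-lower {suc n} k t k≤ = +-mono-≤ (k≤ zero) (∑-lower k (t ∘ suc) (k≤ ∘ suc))

∑-upper : ∀ {n} k (t : Fin n → ℕ) → (∀ i → t i ≤ k) → ∑ t ≤ n * k
∑-upper {zero}  k t ≤k = z≤n
∑-upper {suc n} k t ≤k = +-mono-≤ (≤k zero) (∑-upper k (t ∘ suc) (≤k ∘ suc))

-- A term exceeding `k` would, with the lower bound on all the others, lift the sum above `n * k`.
∑-lower-tight : ∀ {n} k (t : Fin n → ℕ) → (∀ i → k ≤ t i) → ∑ t ≤ n * k → ∀ i → t i ≡ k
∑-lower-tight {suc n} k t k≤ ∑≤ zero =
  ≤-antisym (+-cancelʳ-≤ (n * k) _ _ (≤-trans (+-monoʳ-≤ (t zero) (∑-lower k (t ∘ suc) (k≤ ∘ suc))) ∑≤)) (k≤ zero)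
∑-lower-tight {suc n} k t k≤ ∑≤ (suc i) =
  ∑-lower-tight k (t ∘ suc) (k≤ ∘ suc)
    (+-cancelˡ-≤ k _ _ (≤-trans (+-mono-≤ (k≤ zero) ≤-refl) ∑≤)) i

∑-indicator : ∀ {n} (a : Fin n) → ∑ (λ c → if does (a ≟ c) then 1 else 0) ≡ 1
∑-indicator {suc n} zero    = cong suc (sum-replicate-zero +-0-commutativeMonoid n)
∑-indicator {suc n} (suc a) = ∑-indicator a

-- Each entry lies in exactly one fibre of `g`, so it contributes an indicator function of sum 1.
∑-count : ∀ {A : Set} {k n} (g : A → Fin k) (xs : Vec A n) →
          ∑ (λ c → count (λ x → g x ≟ c) xs) ≡ n
∑-count {k = k} g [] = sum-replicate-zero +-0-commutativeMonoid k
∑-count g (x ∷ xs) =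
  trans (sum-cong-≗ +-0-commutativeMonoid split)
  (trans (∑-distrib-+ +-0-commutativeMonoid (λ c → if does (g x ≟ c) then 1 else 0) _)
  (cong₂ _+_ (∑-indicator (g x)) (∑-count g xs)))
  where
  split : ∀ c → count (λ y → g y ≟ c) (x ∷ xs) ≡
                (if does (g x ≟ c) then 1 else 0) + count (λ y → g y ≟ c) xs
  split c with g x ≟ c
  ... | yes _ = refl
  ... | no  _ = refl

-- Ranks of the entries satisfying a predicate

module _ {A : Set} {p} {P : Pred A p} (P? : Decidable P) where

  -- The rank of position `i` among those satisfying `P`, counted from 0. Together with `select` it
  -- lets the size of a class enter pigeonhole arguments as domain or as codomain.
  locate : ∀ {n} (xs : Vec A n) i → P (lookup xs i) → Fin (count P? xs)
  locate (x ∷ xs) i pi with P? x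
  locate (x ∷ xs) zero    pi | yes _ = zero
  locate (x ∷ xs) (suc i) pi | yes _ = suc (locate xs i pi)
  locate (x ∷ xs) zero    pi | no ¬p = contradiction pi ¬p
  locate (x ∷ xs) (suc i) pi | no _  = locate xs i pi

  locate-injective : ∀ {n} (xs : Vec A n) {i j} pi pj → locate xs i pi ≡ locate xs j pj → i ≡ j
  locate-injective (x ∷ xs) {i} {j} pi pj eq with P? x
  locate-injective (x ∷ xs) {zero}  {zero}  pi pj eq | yes _ = refl
  locate-injective (x ∷ xs) {suc i} {suc j} pi pj eq | yes _ = cong suc (locate-injective xs pi pj (suc-injective eq))
  locate-injective (x ∷ xs) {zero}  {_}     pi pj eq | no ¬p = contradiction pi ¬p
  locate-injective (x ∷ xs) {suc i} {zero}  pi pj eq | no ¬p = contradiction pj ¬p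
  locate-injective (x ∷ xs) {suc i} {suc j} pi pj eq | no _  = cong suc (locate-injective xs pi pj eq)

  select : ∀ {n} (xs : Vec A n) → Fin (count P? xs) → Fin n
  select (x ∷ xs) c with P? x
  select (x ∷ xs) zero    | yes _ = zero
  select (x ∷ xs) (suc c) | yes _ = suc (select xs c)
  select (x ∷ xs) c       | no _  = suc (select xs c)

  select-sound : ∀ {n} (xs : Vec A n) c → P (lookup xs (select xs c))
  select-sound (x ∷ xs) c with P? x
  select-sound (x ∷ xs) zero    | yes px = px
  select-sound (x ∷ xs) (suc c) | yes _  = select-sound xs c
  select-sound (x ∷ xs) c       | no _   = select-sound xs c

  select-injective : ∀ {n} (xs : Vec A n) {c d} → select xs c ≡ select xs d → c ≡ d
  select-injective (x ∷ xs) {c} {d} eq with P? x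
  select-injective (x ∷ xs) {zero}  {zero}  eq | yes _ = refl
  select-injective (x ∷ xs) {suc c} {suc d} eq | yes _ = cong suc (select-injective xs (suc-injective eq))
  select-injective (x ∷ xs) {c}     {d}     eq | no _  = select-injective xs (suc-injective eq)

-- Iterates of a map

module _ {A : Set} {f : A → A} where

  iterate-+ : ∀ x m n → iterate f x (m + n) ≡ iterate f (iterate f x m) n
  iterate-+ x zero    n = refl
  iterate-+ x (suc m) n = iterate-+ (f x) m n

  iterate-injective : Injective _≡_ _≡_ f → ∀ n {x y} → iterate f x n ≡ iterate f y n → x ≡ y
  iterate-injective inj zero    eq = eq
  iterate-injective inj (suc n) eq = inj (iterate-injective inj n eq)

  iterate-*-fixed : ∀ {x} d → iterate f x d ≡ x → ∀ q → iterate f x (q * d) ≡ x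
  iterate-*-fixed d fix zero    = refl
  iterate-*-fixed {x} d fix (suc q) =
    trans (iterate-+ x d (q * d)) (trans (cong (λ y → iterate f y (q * d)) fix) (iterate-*-fixed d fix q))

  iterate-% : ∀ {x} d .{{_ : NonZero d}} → iterate f x d ≡ x → ∀ n → iterate f x (n % d) ≡ iterate f x n
  iterate-% {x} d fix n = sym (trans
    (cong (iterate f x) (trans (m≡m%n+[m/n]*n n d) (+-comm (n % d) _)))
    (trans (iterate-+ x (n / d * d) (n % d)) (cong (λ y → iterate f y (n % d)) (iterate-*-fixed d fix (n / d)))))

  iterate-closed : ∀ {p} (P : Pred A p) → (∀ x → P x → P (f x)) → ∀ x n → P x → P (iterate f x n)
  iterate-closed P step x zero    px = px
  iterate-closed P step x (suc n) px = iterate-closed P step (f x) n (step x px)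

-- Orbit sizes and periods

module _ {n} {f : Fin n → Fin n} (O : Orbits f) where
  open Orbits O

  ∑-card : ∑ card ≡ n
  ∑-card = ∑-count class (allFin n)

  class-iterate : ∀ x k → class (iterate f x k) ≡ class x
  class-iterate x k = sym (Equivalence.from (exact x (iterate f x k)) (k , refl))

  -- Every member of the class is some `iterate f x k`, and `k` can be reduced modulo `d`. The
  -- residue determines the member, so the class injects into `Fin d`.
  card-≤-period : ∀ x d .{{_ : NonZero d}} → iterate f x d ≡ x → card (class x) ≤ d
  card-≤-period x d fix = injective⇒≤ {f = exponent} exponent-injective
    where
    member : Fin (card (class x)) → Fin n
    member = select (λ y → class y ≟ class x) (allFin n)

    power : ∀ c → ∃ λ k → iterate f x k ≡ member c
    power c = Equivalence.to (exact x (member c))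
      (sym (subst (λ y → class y ≡ class x) (lookup-allFin (member c))
        (select-sound (λ y → class y ≟ class x) (allFin n) c)))

    exponent : Fin (card (class x)) → Fin d
    exponent c = fromℕ< (m%n<n (proj₁ (power c)) d)

    exponent-sound : ∀ c → iterate f x (toℕ (exponent c)) ≡ member c
    exponent-sound c = trans (cong (iterate f x) (toℕ-fromℕ< (m%n<n (proj₁ (power c)) d)))
      (trans (iterate-% d fix (proj₁ (power c))) (proj₂ (power c)))

    exponent-injective : Injective _≡_ _≡_ exponent
    exponent-injective {c} {c′} eq = select-injective (λ y → class y ≟ class x) (allFin n)
      (trans (sym (exponent-sound c)) (trans (cong (iterate f x ∘ toℕ) eq) (exponent-sound c′)))

  -- By pigeonhole some positive d ≤ m is a period of x, and d cannot be
  -- smaller than the size m of the orbit.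
  iterate-card : Injective _≡_ _≡_ f → ∀ x → iterate f x (card (class x)) ≡ x
  iterate-card f-injective x =
    let i , j , i<j , eq = pigeonhole (n<1+n m) position
        d   = toℕ j ∸ toℕ i
        fix = iterate-injective f-injective (toℕ i) (trans
                (sym (iterate-+ x d (toℕ i)))
                (trans (cong (iterate f x) (m∸n+n≡m (<⇒≤ i<j)))
                       (sym (position-injective i j eq))))
        d≤m = ≤-trans (m∸n≤m (toℕ j) (toℕ i)) (s≤s⁻¹ (toℕ<n j))
        m≤d = card-≤-period x d {{>-nonZero (m<n⇒0<n∸m i<j)}} fix
    in subst (λ e → iterate f x e ≡ x) (≤-antisym d≤m m≤d) fix
    where
    m = card (class x)

    inClass : ∀ (i : Fin (suc m)) → class (lookup (allFin n) (iterate f x (toℕ i))) ≡ class x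
    inClass i = trans (cong class (lookup-allFin (iterate f x (toℕ i)))) (class-iterate x (toℕ i))

    position : Fin (suc m) → Fin m
    position i = locate (λ y → class y ≟ class x) (allFin n) (iterate f x (toℕ i)) (inClass i)

    position-injective : ∀ i j → position i ≡ position j → iterate f x (toℕ i) ≡ iterate f x (toℕ j)
    position-injective i j = locate-injective (λ y → class y ≟ class x) (allFin n) (inClass i) (inClass j)

-- Injections and sections between finite sets

misses⇒< : ∀ {m n} {g : Fin n → Fin m} → Injective _≡_ _≡_ g → ∀ x → (∀ y → g y ≢ x) → n < m
-- Deleting the missed value `x` from the codomain leaves an injection into a set with one element
-- fewer.
misses⇒< {suc m} inj x miss = s≤s (injective⇒≤ {f = λ y → punchOut (miss y ∘ sym)}
  λ {y} {z} eq → inj (punchOut-injective (miss y ∘ sym) (miss z ∘ sym) eq))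

module _ {m n} {f : Fin m → Fin n} (m≤n : m ≤ n) (section : ∀ y → ∃ λ x → f x ≡ y) where

  private
    g : Fin n → Fin m
    g = proj₁ ∘ section

    g-injective : Injective _≡_ _≡_ g
    g-injective {y} {z} eq = trans (sym (proj₂ (section y))) (trans (cong f eq) (proj₂ (section z)))

  -- The section `g` is injective. If it missed `x`, then `n < m` would follow, against `m≤n`; so
  -- `x` is some `g y`, and then `y` is `f x`.
  section-retracts : ∀ x → proj₁ (section (f x)) ≡ x
  section-retracts x with any? (λ y → g y ≟ x)
  ... | yes (y , refl) = cong g (proj₂ (section y))
  ... | no  miss       = contradiction (≤-trans (misses⇒< g-injective x (λ y eq → miss (y , eq))) m≤n) (<-irrefl refl)

-- The combinatorial model on the 60 sides of the table

Side : Set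
Side = Fin 12 × Fin 5

_≟ₛ_ : DecidableEquality Side
_≟ₛ_ = ≡-dec _≟_ _≟_

open import Data.List.Membership.DecPropositional _≟ₛ_ using (_∈?_)

allSides? : ∀ {p} {P : Side → Set p} → Decidable P → Dec (∀ i k → P (i , k))
allSides? P? = all? λ i → all? λ k → P? (i , k)

-- The index of j among the neighbours of i; 0 if j is not one of them.
slot : Fin 12 → Fin 12 → Fin 5
slot i j with any? (λ k → nbr i k ≟ j)
... | yes (k , _) = k
... | no  _       = # 0

-- The counterparts of `φ`, `α` and `σ`; the last is a composite because `σ` equals `φ ∘ α`
-- pointwise.
turn opposite pivot : Side → Side
turn     (i , k) = i , next k
opposite (i , k) = nbr i k , slot (nbr i k) i
pivot            = turn ∘ opposite

abstract
  slot-nbr : ∀ i k → slot i (nbr i k) ≡ k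
  slot-nbr = from-yes (all? λ i → all? λ k → slot i (nbr i k) ≟ k)

  nbr-irreflexive : ∀ i k → nbr i k ≢ i
  nbr-irreflexive = from-yes (all? λ i → all? λ k → ¬? (nbr i k ≟ i))

  opposite-involutive : ∀ s → opposite (opposite s) ≡ s
  opposite-involutive (i , k) = from-yes (allSides? λ s → opposite (opposite s) ≟ₛ s) i k

  pivot³ : ∀ s → pivot (pivot (pivot s)) ≡ s
  pivot³ (i , k) = from-yes (allSides? λ s → pivot (pivot (pivot s)) ≟ₛ s) i k

-- Propagation of gluings

-- P₁–P₂, …, P₁–P₆, then P₂–P₁₁, P₃–P₇, …, P₆–P₁₀, and P₇–P₁₂.
spanning : List Side
spanning =
  (p₁ , # 0) ∷ (p₁ , # 1) ∷ (p₁ , # 2) ∷ (p₁ , # 3) ∷ (p₁ , # 4) ∷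
  (p₂ , # 2) ∷ (p₃ , # 2) ∷ (p₄ , # 2) ∷ (p₅ , # 2) ∷ (p₆ , # 2) ∷
  (p₇ , # 0) ∷ []

-- The sides known to be glued after `n` rounds. `s`, `pivot s` and `pivot (pivot s)` start at one
-- vertex, so a round adds an edge once the other two edges at one of its ends are present.
Forced : ℕ → Side → Set
Forced zero    s = s ∈ spanning ⊎ opposite s ∈ spanning
Forced (suc n) s = Forced n s ⊎ Around s ⊎ Around (opposite s)
  where
  Around : Side → Set
  Around s = Forced n (pivot s) × Forced n (pivot (pivot s))

forced? : ∀ n → Decidable (Forced n)
forced? zero    s = s ∈? spanning ⊎-dec opposite s ∈? spanning
forced? (suc n) s = forced? n s ⊎-dec around? s ⊎-dec around? (opposite s)
  where
  around? : Decidable λ s → Forced n (pivot s) × Forced n (pivot (pivot s))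
  around? s = forced? n (pivot s) ×-dec forced? n (pivot (pivot s))

abstract
  -- Five rounds starting from the spanning tree reach every side, by a finite check.
  forced : ∀ s → Forced 5 s
  forced (i , k) = from-yes (allSides? (forced? 5)) i k

-- Development of the table from a single dart

module Development {D : Set} (φ α : D → D)
  (α² : ∀ x → α (α x) ≡ x) (φ⁵ : ∀ x → iterate φ x 5 ≡ x)
  (vertex³ : ∀ x → φ (α (φ (α (φ (α x))))) ≡ x)
  (x₀ : D) where

  -- `inner k` is side 0 of the tile across side `k` of P₁. Crossing side 2 of that tile arrives at
  -- side 2 of an outer tile, and three more turns lead to its side 0, since 2 + 3 = 5.
  inner outer : Fin 5 → D
  inner k = α (iterate φ x₀ (toℕ k))
  outer k = iterate φ (α (iterate φ (inner k) 2)) 3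

  root : Fin 12 → D
  root = lookup (x₀ ∷
    inner (# 0) ∷ inner (# 1) ∷ inner (# 2) ∷ inner (# 3) ∷ inner (# 4) ∷
    -- P₃ to P₆ lead outwards to P₇ to P₁₀, while P₂, reached by `inner (# 0)`, leads to P₁₁; hence
    -- the cyclic shift.
    outer (# 1) ∷ outer (# 2) ∷ outer (# 3) ∷ outer (# 4) ∷ outer (# 0) ∷
    α (outer (# 1)) ∷ [])

  place : Side → D
  place (i , k) = iterate φ (root i) (toℕ k)

  place-turn : ∀ s → place (turn s) ≡ φ (place s)
  place-turn (i , zero)                         = refl
  place-turn (i , suc zero)                     = refl
  place-turn (i , suc (suc zero))               = refl
  place-turn (i , suc (suc (suc zero)))         = refl
  place-turn (i , suc (suc (suc (suc zero))))   = sym (φ⁵ (root i))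

  Glued : Side → Set
  Glued s = α (place s) ≡ place (opposite s)

  spanning-glued : All Glued spanning
  spanning-glued =
    refl ∷ refl ∷ refl ∷ refl ∷ refl ∷
    -- Side 2 of an outer tile is two turns past `outer k`, which is itself three turns past the
    -- crossing dart: a full circuit.
    sym (φ⁵ _) ∷ sym (φ⁵ _) ∷ sym (φ⁵ _) ∷ sym (φ⁵ _) ∷ sym (φ⁵ _) ∷
    refl ∷ []

  glued-opposite : ∀ s → Glued (opposite s) → Glued s
  glued-opposite s eq = begin
    α (place s)                       ≡⟨ cong (α ∘ place) (opposite-involutive s) ⟨
    α (place (opposite (opposite s))) ≡⟨ cong α eq ⟨
    α (α (place (opposite s)))        ≡⟨ α² _ ⟩
    place (opposite s)                ∎
    where open ≡-Reasoning

  place-pivot : ∀ s → Glued s → place (pivot s) ≡ φ (α (place s))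
  place-pivot s eq = trans (place-turn (opposite s)) (cong φ (sym eq))

  φ-injective : Injective _≡_ _≡_ φ
  φ-injective {x} {y} eq = trans (sym (φ⁵ x)) (trans (cong (λ z → iterate φ z 4) eq) (φ⁵ y))

  -- At two of the three sides around the vertex `place` carries `pivot` to `φ ∘ α`. As the cube of
  -- `φ ∘ α` is the identity, the value at the third side is determined too, and `φ` can be
  -- cancelled.
  glued-vertex : ∀ s → Glued (pivot s) → Glued (pivot (pivot s)) → Glued s
  glued-vertex s eq₁ eq₂ = φ-injective (begin
    φ (α (place s))                                 ≡⟨ cong (φ ∘ α ∘ place) (pivot³ s) ⟨
    φ (α (place (pivot (pivot (pivot s)))))         ≡⟨ cong (φ ∘ α) (place-pivot (pivot (pivot s)) eq₂) ⟩
    φ (α (φ (α (place (pivot (pivot s))))))         ≡⟨ cong (φ ∘ α ∘ φ ∘ α) (place-pivot (pivot s) eq₁) ⟩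
    φ (α (φ (α (φ (α (place (pivot s)))))))         ≡⟨ vertex³ _ ⟩
    place (pivot s)                                 ≡⟨ place-turn (opposite s) ⟩
    φ (place (opposite s))                          ∎)
    where open ≡-Reasoning

  forced-glued : ∀ n s → Forced n s → Glued s
  forced-glued zero    s (inj₁ s∈) = All.lookup spanning-glued s∈
  forced-glued zero    s (inj₂ s∈) = glued-opposite s (All.lookup spanning-glued s∈)
  forced-glued (suc n) s (inj₁ f) = forced-glued n s f
  forced-glued (suc n) s (inj₂ (inj₁ (f₁ , f₂))) =
    glued-vertex s (forced-glued n _ f₁) (forced-glued n _ f₂)
  forced-glued (suc n) s (inj₂ (inj₂ (f₁ , f₂))) = glued-opposite s
    (glued-vertex (opposite s) (forced-glued n _ f₁) (forced-glued n _ f₂))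

  place-opposite : ∀ s → place (opposite s) ≡ α (place s)
  place-opposite s = sym (forced-glued 5 s (forced s))

-- Numbering of the sides

encode : Side → Fin 60
encode (i , k) = combine i k

decode : Fin 60 → Side
decode = remQuot {12} 5

decode-encode : ∀ s → decode (encode s) ≡ s
decode-encode (i , k) = remQuot-combine i k

-- Counts and relations in an arbitrary tiling by twelve pentagons

module Pentagonal (T : SphericalTiling) (pentagons : ByTwelveCongruentPentagons T) where
  open SphericalTiling T
  open ByCongruentPentagons (proj₁ pentagons)

  #tiles≡12 : #tiles ≡ 12
  #tiles≡12 = proj₂ pentagons

  σ-injective : Injective _≡_ _≡_ σ
  σ-injective = Injection.injective (↔⇒↣ rotation)

  α-injective : Injective _≡_ _≡_ α
  α-injective {x} {y} eq = trans (sym (α-involutive x)) (trans (cong α eq) (α-involutive y))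

  φα≡σ : ∀ x → φ (α x) ≡ σ x
  φα≡σ x = cong σ (α-involutive x)

  #darts≡60 : #darts ≡ 60
  #darts≡60 = trans (sym (∑-card tiles)) (trans
    (≤-antisym (∑-upper 5 perimeter (≤-reflexive ∘ five-edges))
               (∑-lower 5 perimeter (≤-reflexive ∘ sym ∘ five-edges)))
    (cong (_* 5) {#tiles} {12} #tiles≡12))

  #edges≥30 : 30 ≤ #edges
  #edges≥30 = *-cancelʳ-≤ 30 #edges 2 (≤-trans
    (≤-reflexive (trans (sym #darts≡60) (sym (∑-card edges))))
    (∑-upper 2 (Orbits.card edges) edge-card≤2))
    where
    edge-card≤2 : ∀ e → Orbits.card edges e ≤ 2
    edge-card≤2 e =
      let x , onto = Orbits.surjective edges e
      in subst (λ e′ → Orbits.card edges e′ ≤ 2) (onto refl)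
           (card-≤-period edges x 2 (α-involutive x))

  #vertices≥20 : 20 ≤ #vertices
  -- 20 + 12 = 30 + 2 ≤ `#edges + 2` = `#vertices + 12`.
  #vertices≥20 = +-cancelʳ-≤ 12 20 #vertices (≤-trans (+-monoˡ-≤ 2 #edges≥30)
    (≤-reflexive (trans (sym euler) (cong (#vertices +_) #tiles≡12))))

  -- The degrees sum to 60, which is at most `#vertices * 3`, while each is at least 3.
  degree≡3 : ∀ v → degree v ≡ 3
  degree≡3 = ∑-lower-tight 3 degree degree≥3
    (≤-trans (≤-reflexive (trans (∑-card vertices) #darts≡60)) (*-monoˡ-≤ 3 #vertices≥20))

  σ³ : ∀ x → σ (σ (σ x)) ≡ x
  σ³ x = subst (λ k → iterate σ x k ≡ x) (degree≡3 (tail x)) (iterate-card vertices σ-injective x)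

  φ⁵ : ∀ x → iterate φ x 5 ≡ x
  φ⁵ x = subst (λ k → iterate φ x k ≡ x) (five-edges (tile x))
    (iterate-card tiles (α-injective ∘ σ-injective) x)

  φα-cubed : ∀ x → φ (α (φ (α (φ (α x))))) ≡ x
  φα-cubed x rewrite α-involutive x | α-involutive (σ x) | α-involutive (σ (σ x)) = σ³ x

  -- The base dart of the development is arbitrary; dart 0 exists because there are 60 darts.
  x₀ : Dart
  x₀ = cast (sym #darts≡60) (# 0)

  private
    module D = Development φ α α-involutive φ⁵ φα-cubed x₀

  abstract
    place : Side → Dart
    place = D.place

    place-turn : ∀ s → place (turn s) ≡ φ (place s)
    place-turn = D.place-turn

    place-opposite : ∀ s → place (opposite s) ≡ α (place s)
    place-opposite = D.place-opposite

    place-iterate : ∀ i k → place (i , k) ≡ iterate φ (place (i , # 0)) (toℕ k)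
    place-iterate i k = refl

  place-pivot : ∀ s → place (pivot s) ≡ σ (place s)
  place-pivot s = trans (place-turn (opposite s)) (trans (cong φ (place-opposite s)) (φα≡σ (place s)))

  -- The sides correspond bijectively to the darts

  Placed : Dart → Set
  Placed x = ∃ λ s → place s ≡ x

  -- The image of `place` is closed under `σ`, which acts there as `pivot`, so it contains all darts
  -- at a vertex or none.
  same-tail-placed : ∀ {x} y → Placed x → tail x ≡ tail y → Placed y
  same-tail-placed {x} y px eq =
    let k , σᵏx≡y = Equivalence.to (Orbits.exact vertices x y) eq
    in subst Placed σᵏx≡y (iterate-closed Placed
         (λ { _ (s , refl) → pivot s , place-pivot s }) x k px)

  -- By connectedness: once all darts at a vertex are placed, reversing the dart towards the next
  -- vertex of a path gives a placed dart there, hence all of them.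
  placed : ∀ y → Placed y
  placed y = along (connected (tail (place (# 0 , # 0))) (tail y))
    (λ z eq → same-tail-placed z ((# 0 , # 0) , refl) (sym eq)) y refl
    where
    along : ∀ {v w} → Star Adjacent v w → (∀ z → tail z ≡ v → Placed z) → ∀ z → tail z ≡ w → Placed z
    along ε                              at-v = at-v
    along ((x , x-tail , x-head) ◅ path) at-v = along path λ z eq →
      let s , eqₛ = at-v x x-tail
      in same-tail-placed z (opposite s , trans (place-opposite s) (cong α eqₛ)) (trans x-head (sym eq))

  coordinates : Dart → Side
  coordinates = proj₁ ∘ placed

  place-coordinates : ∀ x → place (coordinates x) ≡ x
  place-coordinates = proj₂ ∘ placed

  -- `place` maps the 60 sides onto 60 darts, so the section chosen by `placed` is a two-sided
  -- inverse.
  coordinates-place : ∀ s → coordinates (place s) ≡ s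
  coordinates-place s = begin
    coordinates (place s)                            ≡⟨ decode-encode _ ⟨
    decode (encode (coordinates (place s)))          ≡⟨ cong (decode ∘ encode ∘ coordinates ∘ place) (decode-encode s) ⟨
    decode (proj₁ (section (place (decode (encode s)))))
      ≡⟨ cong decode (section-retracts (≤-reflexive (sym #darts≡60)) section (encode s)) ⟩
    decode (encode s)                                ≡⟨ decode-encode s ⟩
    s                                                ∎
    where
    open ≡-Reasoning

    section : ∀ y → ∃ λ d → place (decode d) ≡ y
    section y = encode (coordinates y) ,
      trans (cong place (decode-encode (coordinates y))) (place-coordinates y)

  place-injective : ∀ s t → place s ≡ place t → s ≡ t
  place-injective s t eq = trans (sym (coordinates-place s)) (trans (cong coordinates eq) (coordinates-place t))

  coordinates-α : ∀ x → coordinates (α x) ≡ opposite (coordinates x)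
  coordinates-α x = place-injective _ _ (trans (place-coordinates (α x))
    (sym (trans (place-opposite (coordinates x)) (cong α (place-coordinates x)))))

  coordinates-σ : ∀ x → coordinates (σ x) ≡ pivot (coordinates x)
  coordinates-σ x = place-injective _ _ (trans (place-coordinates (σ x))
    (sym (trans (place-pivot (coordinates x)) (cong σ (place-coordinates x)))))

  -- Tiles, edges and corners of the labelling

  P : Fin 12 → Tile
  P i = tile (place (i , # 0))

  tile-iterate : ∀ x k → tile (iterate φ x k) ≡ tile x
  tile-iterate = class-iterate tiles

  place-tile : ∀ s → tile (place s) ≡ P (proj₁ s)
  place-tile (i , k) = trans (cong tile (place-iterate i k)) (tile-iterate (place (i , # 0)) (toℕ k))

  tile-coordinates : ∀ x → tile x ≡ P (proj₁ (coordinates x))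
  tile-coordinates x = trans (cong tile (sym (place-coordinates x))) (place-tile (coordinates x))

  OnTile : Fin 12 → Dart → Set
  OnTile i x = ∃ λ k → place (i , k) ≡ x

  -- The sides of row `i` are closed under `φ`, which acts on them as `turn`, so they exhaust the
  -- orbit.
  onTile : ∀ i x → tile x ≡ P i → OnTile i x
  onTile i x eq =
    let k , φᵏ≡x = Equivalence.to (Orbits.exact tiles (place (i , # 0)) x) (sym eq)
    in subst (OnTile i) φᵏ≡x (iterate-closed (OnTile i)
         (λ { _ (k , refl) → next k , place-turn (i , k) }) _ k (# 0 , refl))

  -- Otherwise side 0 of row `i` and some side of row `j` would be placed at the same dart.
  P-injective : ∀ {i j} → P i ≡ P j → i ≡ j
  P-injective {i} {j} eq =
    let k , eq′ = onTile j (place (i , # 0)) eq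
    in cong proj₁ (place-injective (i , # 0) (j , k) (sym eq′))

  same-edge : ∀ x y → edge x ≡ edge y → y ≡ x ⊎ y ≡ α x
  same-edge x y eq =
    let k , αᵏx≡y = Equivalence.to (Orbits.exact edges x y) eq
    in subst (λ z → z ≡ x ⊎ z ≡ α x) αᵏx≡y
         (iterate-closed (λ z → z ≡ x ⊎ z ≡ α x)
           (λ { _ (inj₁ refl) → inj₂ refl ; _ (inj₂ refl) → inj₁ (α-involutive x) }) x k (inj₁ refl))

  edge-α : ∀ x → edge (α x) ≡ edge x
  edge-α x = class-iterate edges x 1

  tail-σ : ∀ x → tail (σ x) ≡ tail x
  tail-σ x = class-iterate vertices x 1

  vertex-darts : ∀ x y → tail x ≡ tail y → y ≡ x ⊎ y ≡ σ x ⊎ y ≡ σ (σ x)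
  vertex-darts x y eq =
    let k , σᵏx≡y = Equivalence.to (Orbits.exact vertices x y) eq
    in subst Rotated σᵏx≡y (iterate-closed Rotated
         (λ { _ (inj₁ refl)        → inj₂ (inj₁ refl)
            ; _ (inj₂ (inj₁ refl)) → inj₂ (inj₂ refl)
            ; _ (inj₂ (inj₂ refl)) → inj₁ (σ³ x) }) x k (inj₁ refl))
    where
    Rotated : Dart → Set
    Rotated z = z ≡ x ⊎ z ≡ σ x ⊎ z ≡ σ (σ x)

  E : Fin 12 → Fin 12 → Edge
  E i j = edge (place (i , slot i j))

  -- The corner after the side of tile `i` that faces tile `j`, taken as the end of that side.
  V : Fin 12 → Fin 12 → Fin 12 → Vertex
  V i j _ = head (place (i , slot i j))

  E-place : ∀ i k → E i (nbr i k) ≡ edge (place (i , k))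
  E-place i k = cong (λ l → edge (place (i , l))) (slot-nbr i k)

  E-reverse : ∀ i k → E (nbr i k) i ≡ edge (place (i , k))
  E-reverse i k = trans (cong edge (place-opposite (i , k))) (edge-α (place (i , k)))

  -- For uniqueness, darts `x` of `P i` and `y` of the neighbour on one edge are distinct because
  -- the tiles are, so `y` is `α x`. Thus `x` faces that neighbour, and `E i` depends only on the
  -- neighbour faced.
  E-common : ∀ i k → IsUniqueCommonEdge (E i (nbr i k)) (P i) (P (nbr i k))
  E-common i k =
    (place (i , k) , sym (E-place i k) , place-tile (i , k)) ,
    (place (opposite (i , k)) , trans (E-reverse i k) (sym (E-place i k)) , place-tile (opposite (i , k))) ,
    unique
    where
    unique : ∀ e → e isEdgeOf P i → e isEdgeOf P (nbr i k) → e ≡ E i (nbr i k)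
    unique e (x , x-edge , x-tile) (y , y-edge , y-tile) =
      let m , at-x = onTile i x x-tile
          l , at-y = onTile (nbr i k) y y-tile

          y≢x : y ≢ x
          y≢x y≡x = nbr-irreflexive i k
            (cong proj₁ (place-injective (nbr i k , l) (i , m) (trans at-y (trans y≡x (sym at-x)))))

          -- `y` is placed both from row `nbr i k` and from the side opposite `(i , m)`, which is in
          -- row `nbr i m`.
          nbr-m : y ≡ α x → nbr i k ≡ nbr i m
          nbr-m y≡αx = cong proj₁ (place-injective (nbr i k , l) (opposite (i , m))
            (trans at-y (trans y≡αx (trans (cong α (sym at-x)) (sym (place-opposite (i , m)))))))
      in [ (λ y≡x → contradiction y≡x y≢x)
         , (λ y≡αx → begin
             e                            ≡⟨ x-edge ⟨
             edge x                       ≡⟨ cong edge at-x ⟨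
             edge (place (i , m))         ≡⟨ E-place i m ⟨
             E i (nbr i m)                ≡⟨ cong (E i) (nbr-m y≡αx) ⟨
             E i (nbr i k)                ∎)
         ]′ (same-edge x y (trans x-edge (sym y-edge)))
      where open ≡-Reasoning

  V-place : ∀ i k → V i (nbr i k) (nbr i (next k)) ≡ head (place (i , k))
  V-place i k = cong (λ l → head (place (i , l))) (slot-nbr i k)

  tail-turn : ∀ i k → tail (place (i , next k)) ≡ head (place (i , k))
  tail-turn i k = trans (cong tail (place-turn (i , k))) (tail-σ (α (place (i , k))))

  -- The darts leaving the corner are placed from `s₁`, `s₂` and `s₀`, in the order of `σ`. They lie
  -- on `P i`, on the tile across side `next k`, and on the tile across side `k`.
  V-tiles : ∀ i k t → V i (nbr i k) (nbr i (next k)) isVertexOf t ⇔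
            (t ≡ P i ⊎ t ≡ P (nbr i k) ⊎ t ≡ P (nbr i (next k)))
  V-tiles i k t = mk⇔ to from
    where
    s₀ s₁ s₂ : Side
    s₀ = opposite (i , k)
    s₁ = i , next k
    s₂ = pivot s₁

    tail-s₀ : tail (place s₀) ≡ V i (nbr i k) (nbr i (next k))
    tail-s₀ = trans (cong tail (place-opposite (i , k))) (sym (V-place i k))

    tail-s₁ : tail (place s₁) ≡ V i (nbr i k) (nbr i (next k))
    tail-s₁ = trans (tail-turn i k) (sym (V-place i k))

    tail-s₂ : tail (place s₂) ≡ V i (nbr i k) (nbr i (next k))
    tail-s₂ = trans (cong tail (place-pivot s₁)) (trans (tail-σ (place s₁)) tail-s₁)

    s₀≡σ²s₁ : place s₀ ≡ σ (σ (place s₁))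
    s₀≡σ²s₁ = begin
      place s₀                  ≡⟨ σ³ (place s₀) ⟨
      σ (σ (σ (place s₀)))      ≡⟨ cong (σ ∘ σ) (place-pivot s₀) ⟨
      σ (σ (place (pivot s₀)))  ≡⟨ cong (σ ∘ σ ∘ place ∘ turn) (opposite-involutive (i , k)) ⟩
      σ (σ (place s₁))          ∎
      where open ≡-Reasoning

    to : V i (nbr i k) (nbr i (next k)) isVertexOf t → t ≡ P i ⊎ t ≡ P (nbr i k) ⊎ t ≡ P (nbr i (next k))
    to (x , x-tail , x-tile) = Sum.map (t≡ s₁)
      -- The rotation meets `s₂` before `s₀`, whereas the statement lists the tile of `s₀` first.
      (Sum.swap ∘ Sum.map (λ eq → t≡ s₂ (trans eq (sym (place-pivot s₁)))) (λ eq → t≡ s₀ (trans eq (sym s₀≡σ²s₁))))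
      (vertex-darts (place s₁) x (trans tail-s₁ (sym x-tail)))
      where
      t≡ : ∀ s → x ≡ place s → t ≡ P (proj₁ s)
      t≡ s eq = trans (sym x-tile) (trans (cong tile eq) (place-tile s))

    from : t ≡ P i ⊎ t ≡ P (nbr i k) ⊎ t ≡ P (nbr i (next k)) → V i (nbr i k) (nbr i (next k)) isVertexOf t
    from (inj₁ refl)        = place s₁ , tail-s₁ , place-tile s₁
    from (inj₂ (inj₁ refl)) = place s₀ , tail-s₀ , place-tile s₀
    from (inj₂ (inj₂ refl)) = place s₂ , tail-s₂ , place-tile s₂

  labelling : DodecahedralLabelling T
  labelling = record
    -- The inverse of `P` reads the row off the coordinates of a dart of the tile.
    { labelling     = permutation P (proj₁ ∘ coordinates ∘ representative)
        (λ t → trans (sym (tile-coordinates (representative t))) (representative-tile t))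
        (λ i → P-injective (trans (sym (tile-coordinates (representative (P i)))) (representative-tile (P i))))
    ; E             = E
    ; E-symmetric   = λ i k → trans (E-place i k) (sym (E-reverse i k))
    ; E-common      = E-common
    ; boundary      = λ i k → place (i , k)
    ; boundary-tile = λ i k → place-tile (i , k)
    ; boundary-edge = λ i k → sym (E-place i k)
    ; boundary-next = λ i k → sym (place-turn (i , k))
    ; V             = V
    ; V-corner      = λ i k → sym (V-place i k) , trans (tail-turn i k) (sym (V-place i k))
    ; V-degree      = λ i k → degree≡3 _
    ; V-tiles       = V-tiles
    }
    where
    representative : Tile → Dart
    representative = proj₁ ∘ Orbits.surjective tiles

    representative-tile : ∀ t → tile (representative t) ≡ t
    representative-tile t = proj₂ (Orbits.surjective tiles t) refl

-- Uniqueness up to isomorphism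

isomorphic : ∀ S T → ByTwelveCongruentPentagons S → ByTwelveCongruentPentagons T → S ≅ T
isomorphic S T pentagonsˢ pentagonsᵗ = record
  { dartBijection = permutation to from to-from from-to
  ; preserves-α   = λ x → trans (cong T.place (S.coordinates-α x)) (T.place-opposite (S.coordinates x))
  -- In both tilings `σ` becomes `pivot` in coordinates, so passing through the table preserves
  -- orientation.
  ; preserves-σ   = inj₁ λ x → trans (cong T.place (S.coordinates-σ x)) (T.place-pivot (S.coordinates x))
  }
  where
  module S = Pentagonal S pentagonsˢ
  module T = Pentagonal T pentagonsᵗ

  to : SphericalTiling.Dart S → SphericalTiling.Dart T
  to = T.place ∘ S.coordinates

  from : SphericalTiling.Dart T → SphericalTiling.Dart S
  from = S.place ∘ T.coordinates

  to-from : ∀ y → to (from y) ≡ y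
  to-from y = trans (cong T.place (S.coordinates-place (T.coordinates y))) (T.place-coordinates y)

  from-to : ∀ x → from (to x) ≡ x
  from-to x = trans (cong S.place (T.coordinates-place (S.coordinates x))) (S.place-coordinates x)

-- Construction of the dodecahedron

-- The k-th entry of row i is the tail of the k-th side of Pᵢ.  Numbering in
-- order of first appearance gives every vertex but 0 a smaller neighbour.
vertexTable : Vec (Vec (Fin 20) 5) 12
vertexTable =
  (# 0  ∷ # 1  ∷ # 2  ∷ # 3  ∷ # 4  ∷ []) ∷
  (# 1  ∷ # 0  ∷ # 5  ∷ # 6  ∷ # 7  ∷ []) ∷
  (# 2  ∷ # 1  ∷ # 7  ∷ # 8  ∷ # 9  ∷ []) ∷
  (# 3  ∷ # 2  ∷ # 9  ∷ # 10 ∷ # 11 ∷ []) ∷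
  (# 4  ∷ # 3  ∷ # 11 ∷ # 12 ∷ # 13 ∷ []) ∷
  (# 0  ∷ # 4  ∷ # 13 ∷ # 14 ∷ # 5  ∷ []) ∷
  (# 15 ∷ # 16 ∷ # 8  ∷ # 7  ∷ # 6  ∷ []) ∷
  (# 16 ∷ # 17 ∷ # 10 ∷ # 9  ∷ # 8  ∷ []) ∷
  (# 17 ∷ # 18 ∷ # 12 ∷ # 11 ∷ # 10 ∷ []) ∷
  (# 18 ∷ # 19 ∷ # 14 ∷ # 13 ∷ # 12 ∷ []) ∷
  (# 19 ∷ # 15 ∷ # 6  ∷ # 5  ∷ # 14 ∷ []) ∷
  (# 16 ∷ # 15 ∷ # 19 ∷ # 18 ∷ # 17 ∷ []) ∷ []

-- Each number stands at the two sides exchanged by `opposite`, again in order of first appearance.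
edgeTable : Vec (Vec (Fin 30) 5) 12
edgeTable =
  (# 0  ∷ # 1  ∷ # 2  ∷ # 3  ∷ # 4  ∷ []) ∷
  (# 0  ∷ # 5  ∷ # 6  ∷ # 7  ∷ # 8  ∷ []) ∷
  (# 1  ∷ # 8  ∷ # 9  ∷ # 10 ∷ # 11 ∷ []) ∷
  (# 2  ∷ # 11 ∷ # 12 ∷ # 13 ∷ # 14 ∷ []) ∷
  (# 3  ∷ # 14 ∷ # 15 ∷ # 16 ∷ # 17 ∷ []) ∷
  (# 4  ∷ # 17 ∷ # 18 ∷ # 19 ∷ # 5  ∷ []) ∷
  (# 20 ∷ # 21 ∷ # 9  ∷ # 7  ∷ # 22 ∷ []) ∷
  (# 23 ∷ # 24 ∷ # 12 ∷ # 10 ∷ # 21 ∷ []) ∷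
  (# 25 ∷ # 26 ∷ # 15 ∷ # 13 ∷ # 24 ∷ []) ∷
  (# 27 ∷ # 28 ∷ # 18 ∷ # 16 ∷ # 26 ∷ []) ∷
  (# 29 ∷ # 22 ∷ # 6  ∷ # 19 ∷ # 28 ∷ []) ∷
  (# 20 ∷ # 29 ∷ # 27 ∷ # 25 ∷ # 23 ∷ []) ∷ []

entry : ∀ {A : Set} → Vec (Vec A 5) 12 → Fin 60 → A
entry table d = let i , k = decode d in lookup (lookup table i) k

abstract
  αᴰ σᴰ : Fin 60 → Fin 60
  αᴰ = encode ∘ opposite ∘ decode
  σᴰ = encode ∘ pivot ∘ decode

  tailᴰ : Fin 60 → Fin 20
  tailᴰ = entry vertexTable

  edgeᴰ : Fin 60 → Fin 30
  edgeᴰ = entry edgeTable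

  tileᴰ : Fin 60 → Fin 12
  tileᴰ = proj₁ ∘ decode

φᴰ : Fin 60 → Fin 60
φᴰ = σᴰ ∘ αᴰ

-- Orbit quotients from explicit class functions

module _ {n size} (f : Fin n → Fin n) (class : Fin n → Fin size) where

  -- One representative reaching its whole fibre in at most four steps: enough for orbits of size 2,
  -- 3 and 5, and decidable by search.
  OrbitOf : Fin size → Fin n → Set
  OrbitOf c x = class x ≡ c × (∀ y → class y ≡ c → ∃ λ (k : Fin 5) → iterate f x (toℕ k) ≡ y)

  fibresAreOrbits? : Dec (∀ c → ∃ (OrbitOf c))
  fibresAreOrbits? = all? λ c → any? λ x → class x ≟ c ×-dec
    all? λ y → (class y ≟ c) →-dec any? λ k → iterate f x (toℕ k) ≟ y

  invariant? : Dec (∀ x → class (f x) ≡ class x)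
  invariant? = all? λ x → class (f x) ≟ class x

  -- Invariance puts each orbit inside a fibre, and the representatives put each fibre inside an
  -- orbit. The period is `suc p`, so `p` forward steps undo one step.
  orbits : ∀ p → (∀ x → iterate f x (suc p) ≡ x) → (∀ x → class (f x) ≡ class x) →
           (∀ c → ∃ (OrbitOf c)) → Orbits f
  orbits p periodic invariant orbit = record
    { size       = size
    ; class      = class
    ; surjective = λ c → let x , class-x , _ = orbit c in x , λ { refl → class-x }
    ; exact      = λ x y → mk⇔ (join x y)
        (λ { (k , refl) → sym (iterate-closed (λ z → class z ≡ class x) (λ z → trans (invariant z)) x k refl) })
    }
    where
    -- If x = fᵏ z and y = fˡ z, then y = fˡ (fᵏᵖ x) because fᵏ⁺ᵏᵖ z = z.
    join : ∀ x y → class x ≡ class y → ∃ λ k → iterate f x k ≡ y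
    join x y eq =
      let z , _ , reaches = orbit (class y)
          k′ , fᵏz≡x = reaches x eq
          l′ , fˡz≡y = reaches y refl
          k = toℕ k′
          l = toℕ l′
      in k * p + l , (begin
        iterate f x (k * p + l)                         ≡⟨ iterate-+ x (k * p) l ⟩
        iterate f (iterate f x (k * p)) l               ≡⟨ cong (λ w → iterate f (iterate f w (k * p)) l) fᵏz≡x ⟨
        iterate f (iterate f (iterate f z k) (k * p)) l ≡⟨ cong (λ w → iterate f w l) (iterate-+ z k (k * p)) ⟨
        iterate f (iterate f z (k + k * p)) l           ≡⟨ cong (λ m → iterate f (iterate f z m) l) (*-suc k p) ⟨
        iterate f (iterate f z (k * suc p)) l           ≡⟨ cong (λ w → iterate f w l) (iterate-*-fixed (suc p) (periodic z) k) ⟩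
        iterate f z l                                   ≡⟨ fˡz≡y ⟩
        y                                               ∎)
      where open ≡-Reasoning

abstract
  αᴰ-involutive : ∀ x → αᴰ (αᴰ x) ≡ x
  αᴰ-involutive = from-yes (all? λ x → αᴰ (αᴰ x) ≟ x)

  αᴰ-no-fixed : ∀ x → αᴰ x ≢ x
  αᴰ-no-fixed = from-yes (all? λ x → ¬? (αᴰ x ≟ x))

  σᴰ³ : ∀ x → σᴰ (σᴰ (σᴰ x)) ≡ x
  σᴰ³ = from-yes (all? λ x → σᴰ (σᴰ (σᴰ x)) ≟ x)

  φᴰ⁵ : ∀ x → iterate φᴰ x 5 ≡ x
  φᴰ⁵ = from-yes (all? λ x → iterate φᴰ x 5 ≟ x)

  tailᴰ-invariant : ∀ x → tailᴰ (σᴰ x) ≡ tailᴰ x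
  tailᴰ-invariant = from-yes (invariant? σᴰ tailᴰ)

  edgeᴰ-invariant : ∀ x → edgeᴰ (αᴰ x) ≡ edgeᴰ x
  edgeᴰ-invariant = from-yes (invariant? αᴰ edgeᴰ)

  tileᴰ-invariant : ∀ x → tileᴰ (φᴰ x) ≡ tileᴰ x
  tileᴰ-invariant = from-yes (invariant? φᴰ tileᴰ)

  tailᴰ-orbits : ∀ v → ∃ (OrbitOf σᴰ tailᴰ v)
  tailᴰ-orbits = from-yes (fibresAreOrbits? σᴰ tailᴰ)

  edgeᴰ-orbits : ∀ e → ∃ (OrbitOf αᴰ edgeᴰ e)
  edgeᴰ-orbits = from-yes (fibresAreOrbits? αᴰ edgeᴰ)

  tileᴰ-orbits : ∀ t → ∃ (OrbitOf φᴰ tileᴰ t)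
  tileᴰ-orbits = from-yes (fibresAreOrbits? φᴰ tileᴰ)

  -- Passing repeatedly to a smaller neighbour ends at vertex 0, which gives connectedness.
  descending : ∀ v → v ≡ # 0 ⊎ ∃ λ x → tailᴰ x ≡ v × tailᴰ (αᴰ x) <ᶠ v
  descending = from-yes (all? λ v → v ≟ # 0 ⊎-dec any? λ x → tailᴰ x ≟ v ×-dec tailᴰ (αᴰ x) <? v)

  tileᴰ-tailᴰ-injective : ∀ x y → tileᴰ x ≡ tileᴰ y → tailᴰ x ≡ tailᴰ y → x ≡ y
  tileᴰ-tailᴰ-injective = from-yes (all? λ x → all? λ y → tileᴰ x ≟ tileᴰ y →-dec tailᴰ x ≟ tailᴰ y →-dec x ≟ y)

  tileᴰ-edgeᴰ-injective : ∀ x y → tileᴰ x ≡ tileᴰ y → edgeᴰ x ≡ edgeᴰ y → x ≡ y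
  tileᴰ-edgeᴰ-injective = from-yes (all? λ x → all? λ y → tileᴰ x ≟ tileᴰ y →-dec edgeᴰ x ≟ edgeᴰ y →-dec x ≟ y)

verticesᴰ : Orbits σᴰ
verticesᴰ = orbits σᴰ tailᴰ 2 σᴰ³ tailᴰ-invariant tailᴰ-orbits

edgesᴰ : Orbits αᴰ
edgesᴰ = orbits αᴰ edgeᴰ 1 αᴰ-involutive edgeᴰ-invariant edgeᴰ-orbits

tilesᴰ : Orbits φᴰ
tilesᴰ = orbits φᴰ tileᴰ 4 φᴰ⁵ tileᴰ-invariant tileᴰ-orbits

abstract
  degreeᴰ : ∀ v → 3 ≤ Orbits.card verticesᴰ v
  degreeᴰ = from-yes (all? λ v → 3 ℕ.≤? Orbits.card verticesᴰ v)

  perimeterᴰ : ∀ t → Orbits.card tilesᴰ t ≡ 5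
  perimeterᴰ = from-yes (all? λ t → Orbits.card tilesᴰ t ℕ.≟ 5)

Adjacentᴰ : Fin 20 → Fin 20 → Set
Adjacentᴰ v w = ∃ λ x → tailᴰ x ≡ v × tailᴰ (αᴰ x) ≡ w

Adjacentᴰ-sym : ∀ {v w} → Adjacentᴰ v w → Adjacentᴰ w v
Adjacentᴰ-sym (x , x-tail , x-head) = αᴰ x , x-head , trans (cong tailᴰ (αᴰ-involutive x)) x-tail

path-to-0 : ∀ v → Acc _<ᶠ_ v → Star Adjacentᴰ v (# 0)
path-to-0 v (acc rec) with descending v
... | inj₁ refl                = ε
... | inj₂ (x , x-tail , head<) = (x , x-tail , refl) ◅ path-to-0 _ (rec head<)

dodecahedron : SphericalTiling
dodecahedron = record
  { #darts       = 60
  ; rotation     = permutation σᴰ (σᴰ ∘ σᴰ) σᴰ³ σᴰ³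
  ; α            = αᴰ
  ; α-involutive = αᴰ-involutive
  ; α-no-fixed   = αᴰ-no-fixed
  ; vertices     = verticesᴰ
  ; edges        = edgesᴰ
  ; tiles        = tilesᴰ
  ; connected    = λ v w → path-to-0 v (<-wellFounded v) ◅◅
                           reverse Adjacentᴰ-sym (path-to-0 w (<-wellFounded w))
  -- 20 + 12 = 30 + 2.
  ; euler        = refl
  ; degree≥3     = degreeᴰ
  }

dodecahedron-pentagonal : ByTwelveCongruentPentagons dodecahedron
dodecahedron-pentagonal = record
  { five-edges      = perimeterᴰ
  ; simple-vertices = tileᴰ-tailᴰ-injective
  ; simple-edges    = tileᴰ-edgeᴰ-injective
  } , refl

-- The first clause shows that the other two are not vacuous.
proposition5 : (∃ λ T → ByTwelveCongruentPentagons T) ×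
    (∀ S T → ByTwelveCongruentPentagons S → ByTwelveCongruentPentagons T → S ≅ T) ×
    (∀ T → ByTwelveCongruentPentagons T → DodecahedralLabelling T)
proposition5 = (dodecahedron , dodecahedron-pentagonal) , isomorphic , Pentagonal.labelling
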